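{- Let $n, d \ge 1$ be integers, let $\langle L, R\rangle$ be an orthogonal vectors instance consisting of two sets $L = \{l_1,\dots,l_n\}$ and $R=\{r_1,\dots,r_n\}$ of $d$-dimensional bit vectors of size $n$ each, and let $\ell \geq 1$, $p \in \{0,1\}$, and $q \geq 0$ be integers. Then the unweighted, undirected graph $G := G_{L,R,\ell,p,q}$ has $O(nd\ell + dq)$ vertices and $O(nd\ell+dq)$ edges, and its diameter $D$ has the following property: if $\langle L, R\rangle$ contains an orthogonal pair, then $D = 6\ell - 3p + q$, and if $\langle L,R\rangle$ contains no orthogonal pair, then $D = 4\ell - 2p + q$.
   Context: Bit vectors $l, r\in\{0,1\}^d$ are orthogonal if for every $1\le k\le d$, $l[k]=0$ or $r[k]=0$. The instance $\langle L,R\rangle$ contains an orthogonal pair if some $l_i\in L$ and $r_j\in R$ are orthogonal. Definition of $G_{L,R,\ell,p,q}$ (unweighted, undirected). The graph has the following exterior vertices: $u_1^L,\dots,u_n^L$, $u_1^R,\dots,u_n^R$, $v_1^L,\dots,v_n^L$, $v_1^R,\dots,v_n^R$, $w_1^L,\dots,w_d^L$, $w_1^R,\dots,w_d^R$, $x^L$, $x^R$, $y^L$, $y^R$. These are connected by the following paths, where $\pi(a,b)$ denotes the path added between $a$ and $b$, its length is its number of edges, each path introduces its own separate set of interior vertices, and a path of length $0$ between $a$ and $b$ means that $a$ and $b$ are identified: (1) for every $1\le i\le n$, paths $\pi(u_i^L,v_i^L)$ and $\pi(u_i^R,v_i^R)$, each of length $\ell-p$; (2) for every $1\le i\le n$,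 paths $\pi(v_i^L,x^L)$ and $\pi(v_i^R,x^R)$, each of length $\ell$; (3) for every $1\le i\le n$ and $1\le k\le d$ with $l_i[k]=1$, a path $\pi(v_i^L,w_k^L)$ of length $\ell$; (4) for every $1\le i\le n$ and $1\le k\le d$ with $r_i[k]=1$, a path $\pi(v_i^R,w_k^R)$ of length $\ell$; (5) for every $1\le k\le d$, paths $\pi(y^L,w_k^L)$ and $\pi(y^R,w_k^R)$, each of length $\ell$; (6) for every $1\le k\le d$, a path $\pi(w_k^L,w_k^R)$ of length $q$ (so $w_k^L=w_k^R$ if $q=0$); (7) paths $\pi(x^L,y^L)$ and $\pi(x^R,y^R)$, each of length $\ell-p$; (8) a path $\pi(y^L,y^R)$ of length $p+q$ (so $y^L=y^R$ if $p+q=0$). In particular, if $\ell=1$ and $p=1$, then $x^L=y^L$, $x^R=y^R$, $u_i^L=v_i^L$ and $u_i^R=v_i^R$ for all $i$. The constants hidden in $O(\cdot)$ are absolute. -}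

module Defs where

open import Data.Bool using (Bool; true; false)
open import Data.Fin using (Fin; toℕ)
open import Data.Nat using (ℕ; suc; _+_; _∸_; _≤_)
open import Data.Product using (∃₂; ∃-syntax; _×_; _,_)
open import Data.Sum using (_⊎_; inj₁; inj₂)
open import Data.Vec using (Vec; lookup)
open import Function.Bundles using (Bijection)
open import Function.Definitions using (Injective)
open import Level using (0ℓ)
open import Relation.Binary using (Rel; Setoid; Symmetric; _Respects₂_)
open import Relation.Binary.Construct.Closure.Equivalence as Eq using (EqClosure)
open import Relation.Binary.Construct.Closure.Symmetric as Sym using (SymClosure)
open import Relation.Binary.PropositionalEquality as ≡ using (_≡_)

HasCardinality : Setoid 0ℓ 0ℓ → ℕ → Set
HasCardinality S k = Bijection (≡.setoid (Fin k)) S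

-- The vertices form a setoid, so that vertices can be identified.
record Graph : Set₁ where
  field
    vertices  : Setoid 0ℓ 0ℓ
  open Setoid vertices public using (_≈_) renaming (Carrier to Vertex)
  field
    Adj       : Rel Vertex 0ℓ
    Adj-sym   : Symmetric Adj
    Adj-resp  : Adj Respects₂ _≈_

module _ (G : Graph) where
  open Graph G
  private module V = Setoid vertices

  -- Edges are unordered pairs of adjacent vertices.
  edges : Setoid 0ℓ 0ℓ
  edges = record
    { Carrier = ∃₂ Adj
    ; _≈_ = λ { (a , b , _) (a′ , b′ , _) →
                (a ≈ a′ × b ≈ b′) ⊎ (a ≈ b′ × b ≈ a′) }
    ; isEquivalence = record
      { refl  = inj₁ (V.refl , V.refl)
      ; sym   = λ { (inj₁ (e , f)) → inj₁ (V.sym e , V.sym f)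
                  ; (inj₂ (e , f)) → inj₂ (V.sym f , V.sym e) }
      ; trans = λ { (inj₁ (e , f)) (inj₁ (g , h)) → inj₁ (V.trans e g , V.trans f h)
                  ; (inj₁ (e , f)) (inj₂ (g , h)) → inj₂ (V.trans e g , V.trans f h)
                  ; (inj₂ (e , f)) (inj₁ (g , h)) → inj₂ (V.trans e h , V.trans f g)
                  ; (inj₂ (e , f)) (inj₂ (g , h)) → inj₁ (V.trans e h , V.trans f g) }
      }
    }

  data Walk : Vertex → Vertex → ℕ → Set where
    stop : ∀ {a b} → a ≈ b → Walk a b 0
    step : ∀ {a b c k} → Adj a b → Walk b c k → Walk a c (suc k)

  IsDistance : Vertex → Vertex → ℕ → Set
  IsDistance a b k = Walk a b k × (∀ m → Walk a b m → k ≤ m)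

  IsDiameter : ℕ → Set
  IsDiameter D = (∀ a b → ∃[ k ] (IsDistance a b k × k ≤ D))
               × (∃₂ λ a b → IsDistance a b D)

-- Exterior vertices joined by internally disjoint paths of given lengths.
record PathSystem : Set₁ where
  field
    Exterior      : Set
    Path          : Set
    source target : Path → Exterior
    len           : Path → ℕ

module _ (P : PathSystem) where
  open PathSystem P

  data Point : Set where
    ext : Exterior → Point
    int : (π : Path) → Fin (len π ∸ 1) → Point

  data Glue : Rel Point 0ℓ where
    glue : ∀ π → len π ≡ 0 → Glue (ext (source π)) (ext (target π))

  -- At π t a : a is the point of π at distance t along π from its source.
  data At (π : Path) : ℕ → Point → Set where
    start  : At π 0 (ext (source π))
    middle : ∀ t → At π (suc (toℕ t)) (int π t)
    end    : At π (len π) (ext (target π))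

  Consecutive : Rel Point 0ℓ
  Consecutive a b = ∃₂ λ π t → At π t a × At π (suc t) b

  subdivision : Graph
  subdivision = record
    { vertices = Eq.setoid Glue
    ; Adj      = λ a b → ∃₂ λ a′ b′ →
                   EqClosure Glue a a′ × EqClosure Glue b b′ × SymClosure Consecutive a′ b′
    ; Adj-sym  = λ { (a′ , b′ , e , f , s) → b′ , a′ , f , e , Sym.symmetric Consecutive s }
    ; Adj-resp = (λ { g (a′ , b′ , e , f , s) → a′ , b′ , e , trans (sym g) f , s })
               , (λ { g (a′ , b′ , e , f , s) → a′ , b′ , trans (sym g) e , f , s })
    }
    where open Setoid (Eq.setoid Glue) using (sym; trans)

BitVector : ℕ → Set
BitVector d = Vec Bool d

Orthogonal : ∀ {d} → BitVector d → BitVector d → Set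
Orthogonal l r = ∀ k → lookup l k ≡ false ⊎ lookup r k ≡ false

data Side : Set where
  left right : Side

-- Injectivity says that the two sets have exactly n elements each.
record OVInstance (n d : ℕ) : Set where
  field
    vec     : Side → Fin n → BitVector d
    vec-inj : ∀ s → Injective _≡_ _≡_ (vec s)

ContainsOrthogonalPair : ∀ {n d} → OVInstance n d → Set
ContainsOrthogonalPair I = ∃₂ λ i j → Orthogonal (vec left i) (vec right j)
  where open OVInstance I

module _ {n d : ℕ} (I : OVInstance n d) (ℓ p q : ℕ) where
  open OVInstance I

  data OVExterior : Set where
    u v : Side → Fin n → OVExterior
    w   : Side → Fin d → OVExterior
    x y : Side → OVExterior

  data OVPath : Set where
    uv : Side → Fin n → OVPath
    vx : Side → Fin n → OVPath
    vw : (s : Side) (i : Fin n) (k : Fin d) → lookup (vec s i) k ≡ true → OVPath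
    yw : Side → Fin d → OVPath
    ww : Fin d → OVPath
    xy : Side → OVPath
    yy : OVPath

  OVSource OVTarget : OVPath → OVExterior
  OVSource (uv s i)     = u s i
  OVSource (vx s i)     = v s i
  OVSource (vw s i k _) = v s i
  OVSource (yw s k)     = y s
  OVSource (ww k)       = w left k
  OVSource (xy s)       = x s
  OVSource yy           = y left

  OVTarget (uv s i)     = v s i
  OVTarget (vx s i)     = x s
  OVTarget (vw s i k _) = w s k
  OVTarget (yw s k)     = w s k
  OVTarget (ww k)       = w right k
  OVTarget (xy s)       = y s
  OVTarget yy           = y right

  -- The truncated subtraction is exact when p ≤ ℓ.
  OVLength : OVPath → ℕ
  OVLength (uv _ _)     = ℓ ∸ p
  OVLength (vx _ _)     = ℓ
  OVLength (vw _ _ _ _) = ℓ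
  OVLength (yw _ _)     = ℓ
  OVLength (ww _)       = q
  OVLength (xy _)       = ℓ ∸ p
  OVLength yy           = p + q

  OVGraph : Graph
  OVGraph = subdivision record
    { Exterior = OVExterior
    ; Path     = OVPath
    ; source   = OVSource
    ; target   = OVTarget
    ; len      = OVLength
    }

{-# OPTIONS --safe #-}
module Submission where

-- Put h = ℓ - p. As p ≤ 1, every point lies within h of some v, or has distances a and b
-- to x left and x right with a, b ≤ 2h + p + q and a + b ≤ 4h + 2p + q. Since every v is within ℓ of its x,
-- all pairs of points are within 4h + 2p + q of each other, except that two points close to
-- v's of different sides are within 2h + d(v left i, v right j). The latter distance is
-- at most 2ℓ + q along a common 1-bit, and at most 4h + 3p + q through the x's and y's.
-- For the lower bound, a function on the exterior vertices that changes along each path by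
-- at most its length extends to a 1-Lipschitz function on the whole subdivision.
-- Distances exist because walks of a given length can be searched for in the finite list of edges.

open import Algebra.Properties.CommutativeSemigroup using (interchange)
open import Axiom.UniquenessOfIdentityProofs using (module Decidable⇒UIP)
open import Data.Bool as Bool using (Bool; true; false; if_then_else_)
open import Data.Bool.Properties as Bool using ()
open import Data.Fin using (Fin; zero; suc; toℕ; fromℕ<)
open import Data.Fin.Properties as Fin using (toℕ<n; toℕ-fromℕ<; any?; all?; ¬∀⟶∃¬)
open import Data.List using (List; []; _∷_; _++_; map; concatMap; deduplicate; length; lookup; allFin)
open import Data.List.Properties using (length-deduplicate; length-map; length-++; length-tabulate)
open import Data.List.Membership.Propositional.Properties using (∈-concatMap⁺; ∈-map⁺; ∈-++⁺ˡ; ∈-++⁺ʳ; ∈-allFin; ∈-lookup)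
open import Data.List.Membership.Setoid.Properties using (∈-deduplicate⁺)
open import Data.List.Relation.Unary.All as All using ()
open import Data.List.Relation.Unary.AllPairs using (_∷_)
open import Data.List.Relation.Unary.Any as Any using (Any; here; there; index)
open import Data.List.Relation.Unary.Any.Properties as Any using (lookup-index)
open import Data.List.Relation.Unary.Unique.Setoid using (Unique)
open import Data.List.Relation.Unary.Unique.DecSetoid.Properties using (deduplicate-!)
open import Data.Nat using (ℕ; zero; suc; _+_; _*_; _∸_; _⊓_; _≤_; _<_; z≤n; s≤s; NonZero; >-nonZero⁻¹)
open import Data.Nat.Properties
open import Data.Nat.Tactic.RingSolver using (solve; solve-∀)
open import Data.Product using (Σ; Σ-syntax; ∃; ∃₂; ∃-syntax; _×_; _,_; proj₁; proj₂; swap)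
open import Data.Product.Properties as Product using ()
open import Data.Sum using (_⊎_; inj₁; inj₂; [_,_])
open import Data.Sum.Properties as Sum using ()
open import Data.Unit using (⊤; tt)
open import Data.Unit.Properties as Unit using ()
import Data.Vec as Vec
open import Function using (_∘_)
open import Level using (0ℓ)
open import Relation.Binary as Binary using (DecSetoid; Setoid; DecidableEquality)
open import Relation.Binary.Construct.Closure.Equivalence as Eq using ()
open import Relation.Binary.Construct.Closure.Symmetric using (fwd; bwd)
open import Relation.Binary.PropositionalEquality as ≡ using (_≡_; refl; cong; cong₂; subst)
open import Relation.Nullary using (¬_; Dec; yes; no; contradiction)
open import Relation.Nullary.Decidable using (map′; _×-dec_; _⊎-dec_)
open import Relation.Unary using (Pred; Decidable)
open import Defs

-- Finite setoids: covering lists and cardinalities.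

-- Repetitions up to `≈` are allowed, so that a covering list can be written down before knowing
-- which elements are identified.
CoveredBy : Setoid 0ℓ 0ℓ → ℕ → Set
CoveredBy S N = Σ[ xs ∈ List Carrier ] (∀ a → Any (a ≈_) xs) × length xs ≤ N
  where open Setoid S

module _ (S : Setoid 0ℓ 0ℓ) where
  open Setoid S hiding (refl)

  lookup-injective : ∀ {xs} → Unique S xs → ∀ i j → lookup xs i ≈ lookup xs j → i ≡ j
  lookup-injective (_ ∷ _)   zero    zero    _ = refl
  lookup-injective (ps ∷ _)  zero    (suc j) e =
    contradiction e (All.lookup ps (∈-lookup j))
  lookup-injective (ps ∷ _)  (suc i) zero    e =
    contradiction (sym e) (All.lookup ps (∈-lookup i))
  lookup-injective (_ ∷ uxs) (suc i) (suc j) e = cong suc (lookup-injective uxs i j e)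

  -- Deduplication along the decidable `≈` keeps one representative of each class, so the positions
  -- in the resulting list are in bijection with the classes.
  covered⇒cardinality : Binary.Decidable _≈_ → ∀ {N} → CoveredBy S N →
                        ∃[ k ] (HasCardinality S k × k ≤ N)
  covered⇒cardinality _≟_ (xs , covers , len≤) = length ys , bijection , ≤-trans (length-deduplicate _≟_ xs) len≤
    where
    DS : DecSetoid 0ℓ 0ℓ
    DS = record { isDecEquivalence = record { isEquivalence = isEquivalence ; _≟_ = _≟_ } }
    ys = deduplicate _≟_ xs
    ∈ys : ∀ a → Any (a ≈_) ys
    ∈ys a = ∈-deduplicate⁺ S _≟_ (λ e f → trans f (sym e)) (covers a)
    bijection : HasCardinality S (length ys)
    bijection = record
      { to        = lookup ys
      ; cong      = λ { refl → Setoid.refl S }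
      ; bijective = (λ {i} {j} → lookup-injective (deduplicate-! DS xs) i j)
                  , λ a → index (∈ys a) , λ { refl → sym (lookup-index (∈ys a)) }
      }

FiniteBy : Set → ℕ → Set
FiniteBy A = CoveredBy (≡.setoid A)

finite-Fin : ∀ n → FiniteBy (Fin n) n
finite-Fin n = allFin n , ∈-allFin , ≤-reflexive (length-tabulate {n = n} (λ i → i))

finite-⊎ : ∀ {A B m n} → FiniteBy A m → FiniteBy B n → FiniteBy (A ⊎ B) (m + n)
finite-⊎ (xs , ∈xs , xs≤) (ys , ∈ys , ys≤) =
  map inj₁ xs ++ map inj₂ ys
  , (λ { (inj₁ a) → ∈-++⁺ˡ (∈-map⁺ inj₁ (∈xs a))
       ; (inj₂ b) → ∈-++⁺ʳ (map inj₁ xs) (∈-map⁺ inj₂ (∈ys b)) })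
  , subst (_≤ _)
      (≡.sym (≡.trans (length-++ (map inj₁ xs))
                      (cong₂ _+_ (length-map inj₁ xs) (length-map inj₂ ys))))
      (+-mono-≤ xs≤ ys≤)

length-concatMap-≤ : ∀ {A B : Set} (f : A → List B) n → (∀ a → length (f a) ≤ n) →
                     ∀ xs → length (concatMap f xs) ≤ length xs * n
length-concatMap-≤ f n f≤ []       = z≤n
length-concatMap-≤ f n f≤ (a ∷ xs) = subst (_≤ _) (≡.sym (length-++ (f a)))
  (+-mono-≤ (f≤ a) (length-concatMap-≤ f n f≤ xs))

finite-Σ : ∀ {A} {B : A → Set} {m n} → FiniteBy A m → (∀ a → FiniteBy (B a) n) →
           FiniteBy (Σ A B) (m * n)
finite-Σ {A} {B} {m} {n} (xs , ∈xs , xs≤) finite-B =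
  concatMap pairs xs
  , (λ { (a , b) → ∈-concatMap⁺ pairs
           (Any.map (λ { refl → ∈-map⁺ (pair a) (proj₁ (proj₂ (finite-B a)) b) }) (∈xs a)) })
  , ≤-trans (length-concatMap-≤ pairs n pairs≤ xs) (*-monoˡ-≤ n xs≤)
  where
  pair : ∀ a → B a → Σ A B
  pair = _,_
  pairs : A → List (Σ A B)
  pairs a = map (pair a) (proj₁ (finite-B a))
  pairs≤ : ∀ a → length (pairs a) ≤ n
  pairs≤ a = subst (_≤ n) (≡.sym (length-map (pair a) (proj₁ (finite-B a)))) (proj₂ (proj₂ (finite-B a)))

-- Serves to count the proofs that a given bit is 1, which are part of the index of a `vw` path.
finite-proposition : ∀ {A} → Dec A → (∀ (a b : A) → a ≡ b) → FiniteBy A 1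
finite-proposition (yes a) irr = a ∷ [] , (λ b → here (irr b a)) , ≤-refl
finite-proposition (no ¬a) irr = [] , (λ a → contradiction a ¬a) , z≤n

finite-image : ∀ {A N} (S : Setoid 0ℓ 0ℓ) (f : A → Setoid.Carrier S) →
               (∀ s → ∃[ a ] Setoid._≈_ S s (f a)) → FiniteBy A N → CoveredBy S N
finite-image S f surj (xs , ∈xs , xs≤) =
  map f xs
  , (λ s → let a , s≈fa = surj s in
       Any.map⁺ (Any.map (λ { refl → s≈fa }) (∈xs a)))
  , subst (_≤ _) (≡.sym (length-map f xs)) xs≤

-- Least witnesses, walks and distances.

-- Turns a walk of some length into a shortest one: the search runs upwards from 0 and stops at the
-- known witness `m` at the latest.
least : ∀ {P : Pred ℕ 0ℓ} → Decidable P → ∀ m → P m →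
        ∃[ k ] ((P k × ∀ j → P j → k ≤ j) × k ≤ m)
least P? zero    p = 0 , (p , λ _ _ → z≤n) , z≤n
least {P} P? (suc m) p with P? 0
... | yes p₀ = 0 , (p₀ , λ _ _ → z≤n) , z≤n
... | no ¬p₀ with least {P ∘ suc} (P? ∘ suc) m p
...   | k , (pk , minimal) , k≤m = suc k , (pk , below) , s≤s k≤m
  where
  below : ∀ j → P j → suc k ≤ j
  below zero    p₀ = contradiction p₀ ¬p₀
  below (suc j) pj = s≤s (minimal j pj)

module _ (G : Graph) where
  open Graph G
  private module V = Setoid vertices

  Walk-respˡ : ∀ {a a′ b k} → a ≈ a′ → Walk G a b k → Walk G a′ b k
  Walk-respˡ e (stop f)   = stop (V.trans (V.sym e) f)
  Walk-respˡ e (step s r) = step (proj₂ Adj-resp e s) r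

  Walk-++ : ∀ {a b c k m} → Walk G a b k → Walk G b c m → Walk G a c (k + m)
  Walk-++ (stop e)   r = Walk-respˡ (V.sym e) r
  Walk-++ (step s q) r = step s (Walk-++ q r)

  Walk-snoc : ∀ {a b c k} → Walk G a b k → Adj b c → Walk G a c (suc k)
  Walk-snoc (stop e)   t = step (proj₂ Adj-resp (V.sym e) t) (stop V.refl)
  Walk-snoc (step s r) t = step s (Walk-snoc r t)

  Walk-sym : ∀ {a b k} → Walk G a b k → Walk G b a k
  Walk-sym (stop e)   = stop (V.sym e)
  Walk-sym (step s r) = Walk-snoc (Walk-sym r) (Adj-sym s)

  Within : ℕ → Vertex → Vertex → Set
  Within K a b = ∃[ k ] (Walk G a b k × k ≤ K)

  Within-refl : ∀ {a} → Within 0 a a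
  Within-refl = 0 , stop V.refl , z≤n

  Within-sym : ∀ {K a b} → Within K a b → Within K b a
  Within-sym (k , r , k≤) = k , Walk-sym r , k≤

  infixr 4 _▷_
  _▷_ : ∀ {K M a b c} → Within K a b → Within M b c → Within (K + M) a c
  (k , q , k≤) ▷ (m , r , m≤) = k + m , Walk-++ q r , +-mono-≤ k≤ m≤

  Within-≤ : ∀ {K M a b} → Within K a b → K ≤ M → Within M a b
  Within-≤ (k , r , k≤) K≤M = k , r , ≤-trans k≤ K≤M

  within-bound⇒distance : ∀ {K a b} → Within K a b → (∀ k → Walk G a b k → K ≤ k) → IsDistance G a b K
  within-bound⇒distance {a = a} {b} (k , r , k≤K) K≤ = subst (Walk G a b) (≤-antisym k≤K (K≤ k r)) r , K≤

  edges-decidable : Binary.Decidable _≈_ → Binary.Decidable (Setoid._≈_ (edges G))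
  edges-decidable _≟_ (a , b , _) (a′ , b′ , _) =
    (a ≟ a′ ×-dec b ≟ b′) ⊎-dec (a ≟ b′ ×-dec b ≟ a′)

  -- By recursion on the length: the first step of a nonempty walk is, in one of two orientations, a
  -- listed edge, so finitely many first steps have to be tried.
  Walk-decidable : Binary.Decidable _≈_ → ∀ {M} → CoveredBy (edges G) M → ∀ a b → Decidable (Walk G a b)
  Walk-decidable _≟_ (es , covers , _) = walk?
    where
    WalkVia : Vertex → Vertex → ℕ → Setoid.Carrier (edges G) → Set
    WalkVia a b k (s , t , _) = (a ≈ s × Walk G t b k) ⊎ (a ≈ t × Walk G s b k)

    via⇒walk : ∀ {a b k} → ∃ (WalkVia a b k) → Walk G a b (suc k)
    via⇒walk ((s , t , st) , inj₁ (e , r)) = step (proj₂ Adj-resp (V.sym e) st) r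
    via⇒walk ((s , t , st) , inj₂ (e , r)) = step (proj₂ Adj-resp (V.sym e) (Adj-sym st)) r

    walk⇒via : ∀ {a b k} → Walk G a b (suc k) → Any (WalkVia a b k) es
    walk⇒via (step {a} {c} s r) = Any.map
      (λ { (inj₁ (e , f)) → inj₁ (e , Walk-respˡ f r)
         ; (inj₂ (e , f)) → inj₂ (e , Walk-respˡ f r) })
      (covers (a , c , s))

    walk? : ∀ a b k → Dec (Walk G a b k)
    walk? a b zero    = map′ stop (λ { (stop e) → e }) (a ≟ b)
    walk? a b (suc k) = map′ (via⇒walk ∘ Any.satisfied) walk⇒via
      (Any.any? (λ { (s , t , _) → (a ≟ s ×-dec walk? t b k) ⊎-dec (a ≟ t ×-dec walk? s b k) }) es)

-- Subdivided paths: positions, edges, gluing and potentials.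

retract-≟ : ∀ {A C : Set} (encode : A → C) (decode : C → A) → (∀ a → decode (encode a) ≡ a) →
            DecidableEquality C → DecidableEquality A
retract-≟ encode decode inverse _≟_ a b = map′
  (λ e → ≡.trans (≡.sym (inverse a)) (≡.trans (cong decode e) (inverse b)))
  (cong encode)
  (encode a ≟ encode b)

suc<⇒<∸1 : ∀ {t n} → suc t < n → t < n ∸ 1
suc<⇒<∸1 (s≤s h) = h

<∸1⇒suc< : ∀ {t n} → t < n ∸ 1 → suc t < n
<∸1⇒suc< {n = suc n} h = s≤s h

-- Here `a` and `b` are distances to the two ends of a path; one step along it trades a unit of one
-- for a unit of the other, so each term of the minimum changes by one.
⊓-advance-≤ : ∀ m n a b → (m + a) ⊓ (n + suc b) ≤ suc ((m + suc a) ⊓ (n + b))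
⊓-advance-≤ m n a b = ⊓-mono-≤
  (≤-trans (+-monoʳ-≤ m (n≤1+n a)) (n≤1+n _))
  (≤-reflexive (+-suc n b))

⊓-retreat-≤ : ∀ m n a b → (m + suc a) ⊓ (n + b) ≤ suc ((m + a) ⊓ (n + suc b))
⊓-retreat-≤ m n a b = ⊓-mono-≤
  (≤-reflexive (+-suc m a))
  (≤-trans (+-monoʳ-≤ n (n≤1+n b)) (n≤1+n _))

module _ (P : PathSystem) where
  open PathSystem P

  private
    G : Graph
    G = subdivision P
    module V = Setoid (Graph.vertices G)
  open Graph G using (_≈_; Adj)

  collapsed-≈ : ∀ π → len π ≡ 0 → ext (source π) ≈ ext (target π)
  collapsed-≈ π e = Eq.return (glue π e)

  consecutive-adj : ∀ {a b} → Consecutive P a b → Adj a b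
  consecutive-adj c = _ , _ , V.refl , V.refl , fwd c

  -- Turns the index of `At` into equations, since matching directly at a fixed position gets stuck
  -- on unifying it with the abstract `len π`.
  At-inv : ∀ {π t a} → At P π t a →
           (t ≡ 0 × a ≡ ext (source π)) ⊎
           (∃[ f ] t ≡ suc (toℕ f) × a ≡ int π f) ⊎
           (t ≡ len π × a ≡ ext (target π))
  At-inv start      = inj₁ (refl , refl)
  At-inv (middle f) = inj₂ (inj₁ (f , refl , refl))
  At-inv end        = inj₂ (inj₂ (refl , refl))

  At-≤ : ∀ {π t a} → At P π t a → t ≤ len π
  At-≤ start      = z≤n
  At-≤ (middle f) = <⇒≤ (<∸1⇒suc< (toℕ<n f))
  At-≤ end        = ≤-refl

  At-exists : ∀ π {t} → t ≤ len π → ∃[ a ] At P π t a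
  At-exists π {zero}  _ = _ , start
  At-exists π {suc t} h with m≤n⇒m<n∨m≡n h
  ... | inj₂ e = _ , subst (λ k → At P π k _) (≡.sym e) end
  ... | inj₁ st<len = int π f , subst (λ k → At P π (suc k) (int π f)) (toℕ-fromℕ< _) (middle f)
    where f = fromℕ< (suc<⇒<∸1 st<len)

  -- On a path of length 0 the target also sits at position 0, but then it is glued to the source.
  At-start : ∀ {π a} → At P π 0 a → a ≈ ext (source π)
  At-start {π} at with At-inv at
  ... | inj₁ (_ , refl)               = V.refl
  ... | inj₂ (inj₁ (_ , () , _))
  ... | inj₂ (inj₂ (0≡len , refl))    = V.sym (collapsed-≈ π (≡.sym 0≡len))

  At-end : ∀ {π a} → At P π (len π) a → a ≈ ext (target π)
  At-end {π} at with At-inv at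
  ... | inj₁ (len≡0 , refl)           = collapsed-≈ π len≡0
  ... | inj₂ (inj₁ (f , len≡ , refl)) =
    contradiction (<∸1⇒suc< (toℕ<n f)) (<-irrefl (≡.sym len≡))
  ... | inj₂ (inj₂ (_ , refl))        = V.refl

  -- Interior points lie strictly between the ends and are determined by their position; two
  -- different points share a position only on a collapsed path, where they are glued.
  At-unique : ∀ {π t a b} → At P π t a → At P π t b → a ≈ b
  At-unique start      at = V.sym (At-start at)
  At-unique end        at = V.sym (At-end at)
  At-unique {π} (middle f) at with At-inv at
  ... | inj₁ (() , _)
  ... | inj₂ (inj₁ (g , e , refl)) with Fin.toℕ-injective (suc-injective e)
  ...   | refl = V.refl
  At-unique {π} (middle f) at | inj₂ (inj₂ (e , _)) =
    contradiction (<∸1⇒suc< (toℕ<n f)) (<-irrefl e)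

  walk-from-source : ∀ {π} t {a} → At P π t a → Walk G (ext (source π)) a t
  walk-from-source zero    at = stop (V.sym (At-start at))
  walk-from-source {π} (suc t) at =
    let b , at-b = At-exists π (<⇒≤ (At-≤ at)) in
    Walk-snoc G (walk-from-source t at-b) (consecutive-adj (π , t , at-b , at))

  walk-to-target : ∀ {π} k {t a} → t + k ≡ len π → At P π t a → Walk G a (ext (target π)) k
  walk-to-target {π} zero {t} e at =
    stop (At-end (subst (λ j → At P π j _) (≡.trans (≡.sym (+-identityʳ t)) e) at))
  walk-to-target {π} (suc k) {t} e at =
    let 1+t+k≡len = ≡.trans (≡.sym (+-suc t k)) e
        b , at-b = At-exists π (m+n≤o⇒m≤o (suc t) (≤-reflexive 1+t+k≡len))
    in step (consecutive-adj (π , t , at , at-b)) (walk-to-target k 1+t+k≡len at-b)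

  within-source : ∀ π f → Within G (suc (toℕ f)) (int π f) (ext (source π))
  within-source π f = Within-sym G (_ , walk-from-source _ (middle f) , ≤-refl)

  within-target : ∀ π f → Within G (len π ∸ suc (toℕ f)) (int π f) (ext (target π))
  within-target π f = _ , walk-to-target _ (m+[n∸m]≡n (At-≤ (middle f))) (middle f) , ≤-refl

  within-length : ∀ π → Within G (len π) (ext (source π)) (ext (target π))
  within-length π = _ , walk-from-source _ end , ≤-refl

  -- The slot `(π , f)` stands for the edge from position `f` to position `f + 1` of `π`. Every edge
  -- arises this way up to orientation, as `At-≤` bounds the position of its far end by `len π`.
  Slot : Set
  Slot = Σ[ π ∈ Path ] Fin (len π)

  slot-edge : Slot → ∃₂ Adj
  slot-edge (π , f) =
    let a , at-a = At-exists π (<⇒≤ (toℕ<n f))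
        b , at-b = At-exists π (toℕ<n f)
    in a , b , consecutive-adj (π , toℕ f , at-a , at-b)

  edges-covered : ∀ {M} → FiniteBy Slot M → CoveredBy (edges G) M
  edges-covered = finite-image (edges G) slot-edge surjective
    where
    surjective : ∀ s → ∃[ a ] Setoid._≈_ (edges G) s (slot-edge a)
    surjective (a , b , _ , _ , a≈ , b≈ , fwd (π , t , at-a , at-b)) =
      (π , fromℕ< t<len) , inj₁ (V.trans a≈ (At-unique at-a′ (proj₂ (At-exists π _)))
                          , V.trans b≈ (At-unique at-b′ (proj₂ (At-exists π _))))
      where
      t<len = At-≤ at-b
      t≡ = ≡.sym (toℕ-fromℕ< t<len)
      at-a′ = subst (λ k → At P π k _) t≡ at-a
      at-b′ = subst (λ k → At P π (suc k) _) t≡ at-b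
    surjective (a , b , _ , _ , a≈ , b≈ , bwd (π , t , at-b , at-a)) =
      (π , fromℕ< t<len) , inj₂ (V.trans a≈ (At-unique at-a′ (proj₂ (At-exists π _)))
                          , V.trans b≈ (At-unique at-b′ (proj₂ (At-exists π _))))
      where
      t<len = At-≤ at-a
      t≡ = ≡.sym (toℕ-fromℕ< t<len)
      at-a′ = subst (λ k → At P π (suc k) _) t≡ at-a
      at-b′ = subst (λ k → At P π k _) t≡ at-b

  -- An interior point is the first end of the slot at its own position, so slots cover all interior
  -- points.
  vertices-covered : ∀ {E M} → FiniteBy Exterior E → FiniteBy Slot M →
                     CoveredBy (Graph.vertices G) (E + M)
  vertices-covered finite-E finite-S =
    finite-image (Graph.vertices G) [ ext , proj₁ ∘ slot-edge ] surjective (finite-⊎ finite-E finite-S)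
    where
    surjective : ∀ s → ∃[ a ] s ≈ [ ext , proj₁ ∘ slot-edge ] a
    surjective (ext e)   = inj₁ e , V.refl
    surjective (int π f) =
      inj₂ (π , fromℕ< f<len) ,
      At-unique (subst (λ k → At P π k _) (≡.sym (toℕ-fromℕ< f<len)) (middle f)) (proj₂ (At-exists π _))
      where f<len = <∸1⇒suc< (toℕ<n f)

  module _ (_≟ᴱ_ : DecidableEquality Exterior) (_≟ᴾ_ : DecidableEquality Path) where

    Point-≟ : DecidableEquality (Point P)
    Point-≟ = retract-≟ encode decode (λ { (ext _) → refl ; (int _ _) → refl })
                        (Sum.≡-dec _≟ᴱ_ (Product.≡-dec _≟ᴾ_ Fin._≟_))
      where
      encode : Point P → Exterior ⊎ Σ[ π ∈ Path ] Fin (len π ∸ 1)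
      encode (ext e)   = inj₁ e
      encode (int π f) = inj₂ (π , f)
      decode : Exterior ⊎ Σ[ π ∈ Path ] Fin (len π ∸ 1) → Point P
      decode (inj₁ e)       = ext e
      decode (inj₂ (π , f)) = int π f

    -- `rep` selects one exterior vertex from each glued class and interior points are never glued,
    -- so `≈` amounts to equality of canonical forms: every point is glued to its form, and each
    -- generating identification preserves forms.
    ≈-decidable : (rep : Exterior → Exterior) → (∀ e → ext e ≈ ext (rep e)) →
                  (∀ π → len π ≡ 0 → rep (source π) ≡ rep (target π)) →
                  Binary.Decidable _≈_
    ≈-decidable rep ≈rep rep-glue a b = map′
      (λ e → V.trans (≈Rep a) (V.trans (V.reflexive e) (V.sym (≈Rep b))))
      (Eq.gfold ≡.isEquivalence Rep λ { (glue π e) → cong ext (rep-glue π e) })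
      (Point-≟ (Rep a) (Rep b))
      where
      Rep : Point P → Point P
      Rep (ext e)   = ext (rep e)
      Rep (int π f) = int π f
      ≈Rep : ∀ a → a ≈ Rep a
      ≈Rep (ext e)   = ≈rep e
      ≈Rep (int π f) = V.refl

  module _ (F : Exterior → ℕ)
           (F-lipschitz : ∀ π → F (source π) ≤ F (target π) + len π
                              × F (target π) ≤ F (source π) + len π) where

    -- The McShane extension of `F` along each path, which is the largest 1-Lipschitz function with
    -- the given end values.
    potential : Point P → ℕ
    potential (ext e)   = F e
    potential (int π f) = (F (source π) + suc (toℕ f)) ⊓ (F (target π) + (len π ∸ suc (toℕ f)))

    -- The interior formula persists at the ends because `F-lipschitz` makes the term of the near
    -- end the smaller one.
    potential-At : ∀ {π t a} → At P π t a →
                   potential a ≡ (F (source π) + t) ⊓ (F (target π) + (len π ∸ t))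
    potential-At {π} start = ≡.sym (≡.trans
      (cong (_⊓ (F (target π) + len π)) (+-identityʳ _))
      (m≤n⇒m⊓n≡m (proj₁ (F-lipschitz π))))
    potential-At (middle f) = refl
    potential-At {π} end = ≡.sym (≡.trans
      (cong ((F (source π) + len π) ⊓_) (≡.trans (cong (F (target π) +_) (n∸n≡0 (len π))) (+-identityʳ _)))
      (m≥n⇒m⊓n≡n (proj₂ (F-lipschitz π))))

    -- Gluing happens along paths of length 0, where the two Lipschitz bounds force equal values.
    potential-≈ : ∀ {a b} → a ≈ b → potential a ≡ potential b
    potential-≈ = Eq.gfold ≡.isEquivalence potential λ { (glue π e) →
      let bound : ∀ {m n} → m ≤ n + len π → m ≤ n
          bound = subst (_ ≤_) (≡.trans (cong (_ +_) e) (+-identityʳ _))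
      in ≤-antisym (bound (proj₁ (F-lipschitz π))) (bound (proj₂ (F-lipschitz π))) }

    potential-consecutive : ∀ {a b} → Consecutive P a b →
                            potential a ≤ suc (potential b) × potential b ≤ suc (potential a)
    potential-consecutive (π , t , at-a , at-b)
      rewrite potential-At at-a | potential-At at-b
            -- As `t + 1 ≤ len π`, the distance `len π ∸ t` to the target is the successor of
            -- `len π ∸ suc t`.
            | +-∸-assoc 1 (At-≤ at-b) =
      ⊓-advance-≤ _ _ t _ , ⊓-retreat-≤ _ _ t _

    potential-adj : ∀ {a b} → Adj a b → potential b ≤ suc (potential a)
    potential-adj (_ , _ , a≈ , b≈ , fwd c) rewrite potential-≈ a≈ | potential-≈ b≈ =
      proj₂ (potential-consecutive c)
    potential-adj (_ , _ , a≈ , b≈ , bwd c) rewrite potential-≈ a≈ | potential-≈ b≈ =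
      proj₁ (potential-consecutive c)

    potential-walk : ∀ {a b k} → Walk G a b k → potential b ≤ potential a + k
    potential-walk (stop e) = ≤-reflexive (≡.trans (≡.sym (potential-≈ e)) (≡.sym (+-identityʳ _)))
    potential-walk {a} {k = suc k} (step s r) =
      ≤-trans (potential-walk r) (≤-trans (+-monoˡ-≤ k (potential-adj s)) (≤-reflexive (≡.sym (+-suc _ k))))

-- Bits, sides and elementary inequalities.

-- Ensures that a 1-bit yields a single `vw` path, although the path carries a proof.
Bool-≡-irrelevant : ∀ {a b : Bool} (e f : a ≡ b) → e ≡ f
Bool-≡-irrelevant = Decidable⇒UIP.≡-irrelevant Bool._≟_

by-slack : ∀ {m n} k → m + k ≡ n → m ≤ n
by-slack {m} k e = subst (m ≤_) e (m≤m+n m k)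

-- A Lipschitz check reduced to equations for the ring solver: `a` is the gap between the two values
-- and `b` the slack left in the path length.
by-gap : ∀ {l o} → l ≡ o → ∀ m n a b → m + a ≡ n → a + b ≡ o → m ≤ n + l × n ≤ m + l
by-gap refl m _ a b refl refl =
  ≤-trans (m≤m+n m a) (m≤m+n (m + a) (a + b)) , +-monoʳ-≤ m (m≤m+n a b)

exact-gap : ∀ {l o} → l ≡ o → ∀ m n → m + o ≡ n → m ≤ n + l × n ≤ m + l
exact-gap l≡o m n e = by-gap l≡o m n _ 0 e (+-identityʳ _)

∸-from-+ : ∀ {m n o} → m ≡ n + o → n ≡ m ∸ o
∸-from-+ {n = n} {o} refl = ≡.sym (m+n∸n≡m n o)

m≤o⊎n≤o : ∀ {m n o} → m + n ≤ o + o → m ≤ o ⊎ n ≤ o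
m≤o⊎n≤o {m} {n} {o} h with ≤-total m o
... | inj₁ m≤o = inj₁ m≤o
... | inj₂ o≤m = inj₂ (+-cancelˡ-≤ o n o (≤-trans (+-monoˡ-≤ n o≤m) h))

opposite : Side → Side
opposite left  = right
opposite right = left

_≟ˢ_ : DecidableEquality Side
left  ≟ˢ left  = yes refl
left  ≟ˢ right = no λ ()
right ≟ˢ left  = no λ ()
right ≟ˢ right = yes refl

finite-Side : FiniteBy Side 2
finite-Side = left ∷ right ∷ [] , (λ { left → here refl ; right → there (here refl) }) , ≤-refl

orthogonal? : ∀ {d} (l r : BitVector d) → Dec (Orthogonal l r)
orthogonal? l r = all? λ k → Vec.lookup l k Bool.≟ false ⊎-dec Vec.lookup r k Bool.≟ false

common-bit : ∀ {d} {l r : BitVector d} → ¬ Orthogonal l r →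
             ∃[ k ] (Vec.lookup l k ≡ true × Vec.lookup r k ≡ true)
common-bit {d} {l} {r} ¬orth
  with ¬∀⟶∃¬ d _ (λ k → Vec.lookup l k Bool.≟ false ⊎-dec Vec.lookup r k Bool.≟ false) ¬orth
... | k , ¬k = k , Bool.¬-not (¬k ∘ inj₁) , Bool.¬-not (¬k ∘ inj₂)

contains? : ∀ {n d} (I : OVInstance n d) → Dec (ContainsOrthogonalPair I)
contains? I = any? λ i → any? λ j → orthogonal? (vec left i) (vec right j)
  where open OVInstance I

-- Decidability and finite counts for the instance graph.

module _ {n d : ℕ} (I : OVInstance n d) (ℓ p q : ℕ) where
  open OVInstance I

  OVSystem : PathSystem
  OVSystem = record
    { Exterior = OVExterior I ℓ p q
    ; Path     = OVPath I ℓ p q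
    ; source   = OVSource I ℓ p q
    ; target   = OVTarget I ℓ p q
    ; len      = OVLength I ℓ p q
    }

  private
    G : Graph
    G = OVGraph I ℓ p q
    module V = Setoid (Graph.vertices G)
  open Graph G using (_≈_)

  OVExterior-≟ : DecidableEquality (OVExterior I ℓ p q)
  OVExterior-≟ = retract-≟ encode decode
    (λ { (u _ _) → refl ; (v _ _) → refl ; (w _ _) → refl ; (x _) → refl ; (y _) → refl })
    (Sum.≡-dec side×n? (Sum.≡-dec side×n? (Sum.≡-dec (Product.≡-dec _≟ˢ_ Fin._≟_) (Sum.≡-dec _≟ˢ_ _≟ˢ_))))
    where
    Code = (Side × Fin n) ⊎ (Side × Fin n) ⊎ (Side × Fin d) ⊎ Side ⊎ Side
    side×n? : DecidableEquality (Side × Fin n)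
    side×n? = Product.≡-dec _≟ˢ_ Fin._≟_
    encode : OVExterior I ℓ p q → Code
    encode (u s i) = inj₁ (s , i)
    encode (v s i) = inj₂ (inj₁ (s , i))
    encode (w s k) = inj₂ (inj₂ (inj₁ (s , k)))
    encode (x s)   = inj₂ (inj₂ (inj₂ (inj₁ s)))
    encode (y s)   = inj₂ (inj₂ (inj₂ (inj₂ s)))
    decode : Code → OVExterior I ℓ p q
    decode (inj₁ (s , i))               = u s i
    decode (inj₂ (inj₁ (s , i)))        = v s i
    decode (inj₂ (inj₂ (inj₁ (s , k)))) = w s k
    decode (inj₂ (inj₂ (inj₂ (inj₁ s)))) = x s
    decode (inj₂ (inj₂ (inj₂ (inj₂ s)))) = y s

  Ones : Set
  Ones = Σ[ (s , i , k) ∈ Side × Fin n × Fin d ] Vec.lookup (vec s i) k ≡ true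

  OVPath-≟ : DecidableEquality (OVPath I ℓ p q)
  OVPath-≟ = retract-≟ encode decode
    (λ { (uv _ _) → refl ; (vx _ _) → refl ; (vw _ _ _ _) → refl ; (yw _ _) → refl
       ; (ww _) → refl ; (xy _) → refl ; yy → refl })
    (Sum.≡-dec side×n? (Sum.≡-dec side×n? (Sum.≡-dec ones? (Sum.≡-dec (Product.≡-dec _≟ˢ_ Fin._≟_)
      (Sum.≡-dec Fin._≟_ (Sum.≡-dec _≟ˢ_ Unit._≟_))))))
    where
    Code = (Side × Fin n) ⊎ (Side × Fin n) ⊎ Ones ⊎ (Side × Fin d) ⊎ Fin d ⊎ Side ⊎ ⊤
    side×n? : DecidableEquality (Side × Fin n)
    side×n? = Product.≡-dec _≟ˢ_ Fin._≟_
    ones? : DecidableEquality Ones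
    ones? = Product.≡-dec (Product.≡-dec _≟ˢ_ (Product.≡-dec Fin._≟_ Fin._≟_))
                          (λ e f → yes (Bool-≡-irrelevant e f))
    encode : OVPath I ℓ p q → Code
    encode (uv s i)     = inj₁ (s , i)
    encode (vx s i)     = inj₂ (inj₁ (s , i))
    encode (vw s i k e) = inj₂ (inj₂ (inj₁ ((s , i , k) , e)))
    encode (yw s k)     = inj₂ (inj₂ (inj₂ (inj₁ (s , k))))
    encode (ww k)       = inj₂ (inj₂ (inj₂ (inj₂ (inj₁ k))))
    encode (xy s)       = inj₂ (inj₂ (inj₂ (inj₂ (inj₂ (inj₁ s)))))
    encode yy           = inj₂ (inj₂ (inj₂ (inj₂ (inj₂ (inj₂ tt)))))
    decode : Code → OVPath I ℓ p q
    decode (inj₁ (s , i))                                  = uv s i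
    decode (inj₂ (inj₁ (s , i)))                           = vx s i
    decode (inj₂ (inj₂ (inj₁ ((s , i , k) , e))))          = vw s i k e
    decode (inj₂ (inj₂ (inj₂ (inj₁ (s , k)))))             = yw s k
    decode (inj₂ (inj₂ (inj₂ (inj₂ (inj₁ k)))))            = ww k
    decode (inj₂ (inj₂ (inj₂ (inj₂ (inj₂ (inj₁ s))))))     = xy s
    decode (inj₂ (inj₂ (inj₂ (inj₂ (inj₂ (inj₂ tt))))))    = yy

  finite-exterior : FiniteBy (OVExterior I ℓ p q) (2 * n + (2 * n + (2 * d + (2 + 2))))
  finite-exterior = finite-image (≡.setoid _) decode
    (λ { (u s i) → inj₁ (s , i) , refl
       ; (v s i) → inj₂ (inj₁ (s , i)) , refl
       ; (w s k) → inj₂ (inj₂ (inj₁ (s , k))) , refl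
       ; (x s)   → inj₂ (inj₂ (inj₂ (inj₁ s))) , refl
       ; (y s)   → inj₂ (inj₂ (inj₂ (inj₂ s))) , refl })
    (finite-⊎ side×n (finite-⊎ side×n (finite-⊎ (finite-Σ finite-Side λ _ → finite-Fin d)
      (finite-⊎ finite-Side finite-Side))))
    where
    side×n : FiniteBy (Side × Fin n) (2 * n)
    side×n = finite-Σ finite-Side λ _ → finite-Fin n
    decode : (Side × Fin n) ⊎ (Side × Fin n) ⊎ (Side × Fin d) ⊎ Side ⊎ Side → OVExterior I ℓ p q
    decode (inj₁ (s , i))               = u s i
    decode (inj₂ (inj₁ (s , i)))        = v s i
    decode (inj₂ (inj₂ (inj₁ (s , k)))) = w s k
    decode (inj₂ (inj₂ (inj₂ (inj₁ s)))) = x s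
    decode (inj₂ (inj₂ (inj₂ (inj₂ s)))) = y s

  -- Number of paths times length, in the order `uv`, `vx`, `vw`, `yw`, `ww`, `xy`, `yy`. The `vw`
  -- paths are bounded by the total number of bits; the factor 1 comes from `finite-proposition`.
  slot-count : ℕ
  slot-count = 2 * n * (ℓ ∸ p) + (2 * n * ℓ + (2 * (n * d) * 1 * ℓ + (2 * d * ℓ
             + (d * q + (2 * (ℓ ∸ p) + (p + q))))))

  finite-slots : FiniteBy (Slot OVSystem) slot-count
  finite-slots = finite-image (≡.setoid _) decode
    (λ { (uv s i , t)     → inj₁ ((s , i) , t) , refl
       ; (vx s i , t)     → inj₂ (inj₁ ((s , i) , t)) , refl
       ; (vw s i k e , t) → inj₂ (inj₂ (inj₁ (((s , i , k) , e) , t))) , refl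
       ; (yw s k , t)     → inj₂ (inj₂ (inj₂ (inj₁ ((s , k) , t)))) , refl
       ; (ww k , t)       → inj₂ (inj₂ (inj₂ (inj₂ (inj₁ (k , t))))) , refl
       ; (xy s , t)       → inj₂ (inj₂ (inj₂ (inj₂ (inj₂ (inj₁ (s , t)))))) , refl
       ; (yy , t)         → inj₂ (inj₂ (inj₂ (inj₂ (inj₂ (inj₂ t))))) , refl })
    (finite-⊎ (finite-Σ side×n λ _ → finite-Fin _)
    (finite-⊎ (finite-Σ side×n λ _ → finite-Fin _)
    (finite-⊎ (finite-Σ ones λ _ → finite-Fin _)
    (finite-⊎ (finite-Σ (finite-Σ finite-Side λ _ → finite-Fin d) λ _ → finite-Fin _)
    (finite-⊎ (finite-Σ (finite-Fin d) λ _ → finite-Fin q)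
    (finite-⊎ (finite-Σ finite-Side λ _ → finite-Fin _)
              (finite-Fin _)))))))
    where
    side×n : FiniteBy (Side × Fin n) (2 * n)
    side×n = finite-Σ finite-Side λ _ → finite-Fin n
    ones : FiniteBy Ones (2 * (n * d) * 1)
    ones = finite-Σ (finite-Σ finite-Side λ _ → finite-Σ (finite-Fin n) λ _ → finite-Fin d)
                    (λ _ → finite-proposition (_ Bool.≟ _) Bool-≡-irrelevant)
    decode : ((Side × Fin n) × Fin (ℓ ∸ p)) ⊎ ((Side × Fin n) × Fin ℓ) ⊎ (Ones × Fin ℓ) ⊎
             ((Side × Fin d) × Fin ℓ) ⊎ (Fin d × Fin q) ⊎ (Side × Fin (ℓ ∸ p)) ⊎ Fin (p + q) →
             Slot OVSystem
    decode (inj₁ ((s , i) , t))                             = uv s i , t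
    decode (inj₂ (inj₁ ((s , i) , t)))                      = vx s i , t
    decode (inj₂ (inj₂ (inj₁ (((s , i , k) , e) , t))))     = vw s i k e , t
    decode (inj₂ (inj₂ (inj₂ (inj₁ ((s , k) , t)))))        = yw s k , t
    decode (inj₂ (inj₂ (inj₂ (inj₂ (inj₁ (k , t))))))       = ww k , t
    decode (inj₂ (inj₂ (inj₂ (inj₂ (inj₂ (inj₁ (s , t))))))) = xy s , t
    decode (inj₂ (inj₂ (inj₂ (inj₂ (inj₂ (inj₂ t))))))      = yy , t

  ifZero : ∀ {A : Set} → ℕ → A → A → A
  ifZero zero    a b = a
  ifZero (suc _) a b = b

  ifZero-≈ : ∀ m {e f} → (m ≡ 0 → ext f ≈ ext e) → ext f ≈ ext (ifZero m e f)
  ifZero-≈ zero    f≈e = f≈e refl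
  ifZero-≈ (suc m) f≈e = V.refl

  -- As `1 ≤ ℓ`, the paths that can collapse are `uv`, `xy`, `ww` and `yy`. On collapse, `u` is
  -- represented by `v`, `x` by the representative of `y`, and the right copies of `w` and `y` by
  -- the left ones.
  OV-≈-decidable : 1 ≤ ℓ → Binary.Decidable _≈_
  OV-≈-decidable 1≤ℓ = ≈-decidable OVSystem OVExterior-≟ OVPath-≟ rep ≈rep rep-glue
    where
    rep-y : Side → OVExterior I ℓ p q
    rep-y left  = y left
    rep-y right = ifZero (p + q) (y left) (y right)

    rep : OVExterior I ℓ p q → OVExterior I ℓ p q
    rep (u s i)     = ifZero (ℓ ∸ p) (v s i) (u s i)
    rep (v s i)     = v s i
    rep (w left k)  = w left k
    rep (w right k) = ifZero q (w left k) (w right k)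
    -- Going through `rep-y` makes both ends of a collapsed `xy` path agree regardless of `yy`.
    rep (x s)       = ifZero (ℓ ∸ p) (rep-y s) (x s)
    rep (y s)       = rep-y s

    ≈rep-y : ∀ s → ext (y s) ≈ ext (rep-y s)
    ≈rep-y left  = V.refl
    ≈rep-y right = ifZero-≈ (p + q) (V.sym ∘ collapsed-≈ OVSystem yy)

    ≈rep : ∀ e → ext e ≈ ext (rep e)
    ≈rep (u s i)     = ifZero-≈ (ℓ ∸ p) (collapsed-≈ OVSystem (uv s i))
    ≈rep (v s i)     = V.refl
    ≈rep (w left k)  = V.refl
    ≈rep (w right k) = ifZero-≈ q (V.sym ∘ collapsed-≈ OVSystem (ww k))
    ≈rep (x s)       = ifZero-≈ (ℓ ∸ p) (λ e → V.trans (collapsed-≈ OVSystem (xy s) e) (≈rep-y s))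
    ≈rep (y s)       = ≈rep-y s

    absurd : ∀ {A : Set} → ℓ ≡ 0 → A
    absurd ℓ≡0 = contradiction (subst (1 ≤_) ℓ≡0 1≤ℓ) λ ()

    rep-glue : ∀ π → OVLength I ℓ p q π ≡ 0 → rep (OVSource I ℓ p q π) ≡ rep (OVTarget I ℓ p q π)
    rep-glue (uv s i) e rewrite e = refl
    rep-glue (vx s i) e           = absurd e
    rep-glue (vw s i k _) e       = absurd e
    rep-glue (yw s k) e           = absurd e
    rep-glue (ww k) e rewrite e   = refl
    rep-glue (xy s) e rewrite e   = refl
    rep-glue yy e rewrite e       = refl

-- The half-edge length ℓ ∸ p is abstracted to h, so that the arithmetic is free of subtraction.
module Distances {n d : ℕ} (I : OVInstance n d) (ℓ p q h : ℕ)
                 (p≤1 : p ≤ 1) (h≡ : ℓ ∸ p ≡ h) (ℓ≡ : ℓ ≡ h + p) where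
  open OVInstance I

  private
    G : Graph
    G = OVGraph I ℓ p q
    S : PathSystem
    S = OVSystem I ℓ p q

    Pt : Set
    Pt = Point S

    W : ℕ → Pt → Pt → Set
    W = Within G

    infixr 4 _►_
    _►_ : ∀ {K M a b c} → W K a b → W M b c → W (K + M) a c
    _►_ = _▷_ G

  -- Upper bounds on distances.

  uv-within : ∀ s i → W h (ext (u s i)) (ext (v s i))
  uv-within s i = Within-≤ G (within-length S (uv s i)) (≤-reflexive h≡)

  vx-within : ∀ s i → W (h + p) (ext (v s i)) (ext (x s))
  vx-within s i = Within-≤ G (within-length S (vx s i)) (≤-reflexive ℓ≡)

  xy-within : ∀ s → W h (ext (x s)) (ext (y s))
  xy-within s = Within-≤ G (within-length S (xy s)) (≤-reflexive h≡)

  wx-within : ∀ s k → W (h + p + h) (ext (w s k)) (ext (x s))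
  wx-within s k = Within-sym G (Within-≤ G (within-length S (yw s k)) (≤-reflexive ℓ≡))
                ► Within-sym G (xy-within s)

  yx-opposite-within : ∀ s → W (p + q + h) (ext (y s)) (ext (x (opposite s)))
  yx-opposite-within left  = within-length S yy ► Within-sym G (xy-within right)
  yx-opposite-within right = Within-sym G (within-length S yy) ► Within-sym G (xy-within left)

  -- Retains just the two distance bounds of a point of `π`, so that its ends and its interior
  -- points are treated alike.
  record Along (π : OVPath I ℓ p q) (a : Pt) : Set where
    constructor along
    field
      {before after} : ℕ
      before+after   : before + after ≡ OVLength I ℓ p q π
      to-source      : W before a (ext (OVSource I ℓ p q π))
      to-target      : W after a (ext (OVTarget I ℓ p q π))

  along-source : ∀ π → Along π (ext (OVSource I ℓ p q π))
  along-source π = along refl (Within-refl G) (within-length S π)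

  along-target : ∀ π → Along π (ext (OVTarget I ℓ p q π))
  along-target π = along (+-identityʳ _) (Within-sym G (within-length S π)) (Within-refl G)

  along-interior : ∀ π f → Along π (int π f)
  along-interior π f =
    along (m+[n∸m]≡n (At-≤ S {π} (middle f))) (within-source S π f) (within-target S π f)

  Peripheral : Pt → Set
  Peripheral a = ∃₂ λ s i → W h a (ext (v s i))

  -- `radius≤` serves the pairs of a central and a peripheral point, `radius-sum` the pairs of
  -- central points.
  record Central (a : Pt) : Set where
    constructor mkCentral
    field
      radius     : Side → ℕ
      within-x   : ∀ s → W (radius s) a (ext (x s))
      radius≤    : ∀ s → radius s ≤ 2 * h + p + q
      radius-sum : radius left + radius right ≤ 4 * h + 2 * p + q

  central : ∀ {a m k} s → W m a (ext (x s)) → W k a (ext (x (opposite s))) →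
            m ≤ 2 * h + p + q → k ≤ 2 * h + p + q → m + k ≤ 4 * h + 2 * p + q → Central a
  central {m = m} {k} left α β m≤ k≤ sum = mkCentral
    (λ { left → m ; right → k }) (λ { left → α ; right → β }) (λ { left → m≤ ; right → k≤ }) sum
  central {m = m} {k} right α β m≤ k≤ sum = mkCentral
    (λ { left → k ; right → m }) (λ { left → β ; right → α }) (λ { left → k≤ ; right → m≤ })
    (subst (_≤ 4 * h + 2 * p + q) (+-comm m k) sum)

  -- One route leaves `π` through its source and the other through its target. Each uses at most `L`
  -- edges of `π`, and together they use exactly `L` in the bound, so the sum counts `L` once.
  along⇒central : ∀ {π a m k} L → OVLength I ℓ p q π ≡ L → ∀ s → Along π a →
                  W m (ext (OVSource I ℓ p q π)) (ext (x s)) →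
                  W k (ext (OVTarget I ℓ p q π)) (ext (x (opposite s))) →
                  L + m ≤ 2 * h + p + q → L + k ≤ 2 * h + p + q →
                  L + (m + k) ≤ 4 * h + 2 * p + q → Central a
  along⇒central {m = m} {k} L refl s (along {b} {c} b+c≡L α β) α′ β′ m≤ k≤ sum =
    central s (α ► α′) (β ► β′)
      (≤-trans (+-monoˡ-≤ m (m+n≤o⇒m≤o b (≤-reflexive b+c≡L))) m≤)
      (≤-trans (+-monoˡ-≤ k (m+n≤o⇒n≤o b (≤-reflexive b+c≡L))) k≤)
      (≤-trans (≤-reflexive (≡.trans (interchange +-commutativeSemigroup b m c k) (cong (_+ (m + k)) b+c≡L))) sum)

  xy-central : ∀ s {a} → Along (xy s) a → Central a
  xy-central s on-xy = along⇒central h h≡ s on-xy (Within-refl G) (yx-opposite-within s)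
    (by-slack (h + p + q) (solve (h ∷ p ∷ q ∷ [])))
    (≤-reflexive (solve (h ∷ p ∷ q ∷ [])))
    (by-slack (2 * h + p) (solve (h ∷ p ∷ q ∷ [])))

  ww-central : ∀ k {a} → Along (ww k) a → Central a
  ww-central k on-ww = along⇒central q refl left on-ww (wx-within left k) (wx-within right k)
    (≤-reflexive (solve (h ∷ p ∷ q ∷ [])))
    (≤-reflexive (solve (h ∷ p ∷ q ∷ [])))
    (≤-reflexive (solve (h ∷ p ∷ q ∷ [])))

  yy-central : ∀ {a} → Along yy a → Central a
  yy-central on-yy = along⇒central (p + q) refl left on-yy
    (Within-sym G (xy-within left)) (Within-sym G (xy-within right))
    (by-slack h (solve (h ∷ p ∷ q ∷ [])))
    (by-slack h (solve (h ∷ p ∷ q ∷ [])))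
    (by-slack (2 * h + p) (solve (h ∷ p ∷ q ∷ [])))

  -- An interior position on a path of length `ℓ` is at most `ℓ ∸ 1`, and `p ≤ 1` turns this into
  -- `ℓ ∸ p`.
  interior≤h : ∀ (f : Fin (ℓ ∸ 1)) → suc (toℕ f) ≤ h
  interior≤h f = ≤-trans (toℕ<n f) (≤-trans (∸-monoʳ-≤ ℓ p≤1) (≤-reflexive h≡))

  -- Both routes leave through `y s`, which is within `h`; a detour through `w s k` would be too
  -- costly.
  yw-interior-central : ∀ s k f → Central (int (yw s k) f)
  yw-interior-central s k f = central s
    (γ ► Within-sym G (xy-within s)) (γ ► yx-opposite-within s)
    (by-slack (p + q) (solve (h ∷ p ∷ q ∷ [])))
    (≤-reflexive (solve (h ∷ p ∷ q ∷ [])))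
    (by-slack p (solve (h ∷ p ∷ q ∷ [])))
    where
    γ : W h (int (yw s k) f) (ext (y s))
    γ = Within-≤ G (within-source S (yw s k) f) (interior≤h f)

  classify : ∀ a → Peripheral a ⊎ Central a
  classify (ext (u s i))     = inj₁ (s , i , uv-within s i)
  classify (ext (v s i))     = inj₁ (s , i , Within-≤ G (Within-refl G) z≤n)
  classify (ext (w left k))  = inj₂ (ww-central k (along-source (ww k)))
  classify (ext (w right k)) = inj₂ (ww-central k (along-target (ww k)))
  classify (ext (x s))       = inj₂ (xy-central s (along-source (xy s)))
  classify (ext (y s))       = inj₂ (xy-central s (along-target (xy s)))
  classify (int (uv s i) f)  = inj₁ (s , i , Within-≤ G (within-target S (uv s i) f)
                                               (≤-trans (m∸n≤m (ℓ ∸ p) (suc (toℕ f))) (≤-reflexive h≡)))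
  classify (int (vx s i) f)     = inj₁ (s , i , Within-≤ G (within-source S (vx s i) f) (interior≤h f))
  classify (int (vw s i k e) f) = inj₁ (s , i , Within-≤ G (within-source S (vw s i k e) f) (interior≤h f))
  classify (int (yw s k) f)     = inj₂ (yw-interior-central s k f)
  classify (int (ww k) f)       = inj₂ (ww-central k (along-interior (ww k) f))
  classify (int (xy s) f)       = inj₂ (xy-central s (along-interior (xy s) f))
  classify (int yy f)           = inj₂ (yy-central (along-interior yy f))

  module _ (E : ℕ) (E≥ : 2 * h + 2 * p + q ≤ E)
           (opposite-v : ∀ i j → W E (ext (v left i)) (ext (v right j))) where

    -- Bounds the distance of peripheral points on different sides, the kind of pair affected by
    -- orthogonality. By `E≥`, the bound `4h + 2p + q` for all other pairs fits as well.
    D : ℕ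
    D = h + E + h

    ≤D : 4 * h + 2 * p + q ≤ D
    ≤D = ≤-trans (≤-reflexive (lemma h p q)) (+-monoˡ-≤ h (+-monoʳ-≤ h E≥))
      where
      lemma : ∀ h p q → 4 * h + 2 * p + q ≡ h + (2 * h + 2 * p + q) + h
      lemma = solve-∀

    within-≤D : ∀ {a b K} → W K a b → K ≤ 4 * h + 2 * p + q → W D a b
    within-≤D α K≤ = Within-≤ G α (≤-trans K≤ ≤D)

    peripheral-x : ∀ {a s i} → W h a (ext (v s i)) → W (h + (h + p)) a (ext (x s))
    peripheral-x {s = s} {i} α = α ► vx-within s i

    same-side : ∀ {a b s i j} → W h a (ext (v s i)) → W h b (ext (v s j)) → W D a b
    same-side α β = within-≤D (peripheral-x α ► Within-sym G (peripheral-x β))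
      (by-slack q (solve (h ∷ p ∷ q ∷ [])))

    opposite-sides : ∀ {a b i j} → W h a (ext (v left i)) → W h b (ext (v right j)) → W D a b
    opposite-sides {i = i} {j} α β = (α ► opposite-v i j) ► Within-sym G β

    peripheral-central : ∀ {a b s i} → W h a (ext (v s i)) → Central b → W D a b
    peripheral-central {s = s} α (mkCentral r β r≤ _) =
      within-≤D (peripheral-x α ► Within-sym G (β s))
        (≤-trans (+-monoʳ-≤ (h + (h + p)) (r≤ s)) (≤-reflexive (lemma h p q)))
      where
      lemma : ∀ h p q → h + (h + p) + (2 * h + p + q) ≡ 4 * h + 2 * p + q
      lemma = solve-∀

    -- The routes through x left and through x right have lengths adding up to at most
    -- 2(4h + 2p + q), so the shorter one will do.
    central-central : ∀ {a b} → Central a → Central b → W D a b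
    central-central (mkCentral r α _ r≤) (mkCentral t β _ t≤) =
      [ via left , via right ]
        (m≤o⊎n≤o (≤-trans
          (≤-reflexive (interchange +-commutativeSemigroup (r left) (t left) (r right) (t right)))
          (+-mono-≤ r≤ t≤)))
      where
      via : ∀ s → r s + t s ≤ 4 * h + 2 * p + q → W D _ _
      via s = within-≤D (α s ► Within-sym G (β s))

    within-D : ∀ a b → W D a b
    within-D a b with classify a | classify b
    ... | inj₁ (left  , _ , α) | inj₁ (left  , _ , β) = same-side α β
    ... | inj₁ (right , _ , α) | inj₁ (right , _ , β) = same-side α β
    ... | inj₁ (left  , _ , α) | inj₁ (right , _ , β) = opposite-sides α β
    ... | inj₁ (right , _ , α) | inj₁ (left  , _ , β) = Within-sym G (opposite-sides β α)
    ... | inj₁ (_ , _ , α)     | inj₂ β               = peripheral-central α β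
    ... | inj₂ α               | inj₁ (_ , _ , β)     = Within-sym G (peripheral-central β α)
    ... | inj₂ α               | inj₂ β               = central-central α β

  -- The route through `x left`, `y left`, `y right` and `x right` is available for all vectors,
  -- orthogonal or not.
  opposite-v-orthogonal : ∀ i j → W (4 * h + 3 * p + q) (ext (v left i)) (ext (v right j))
  opposite-v-orthogonal i j = Within-≤ G
    (vx-within left i ► xy-within left ► yx-opposite-within left ► Within-sym G (vx-within right j))
    (≤-reflexive (lemma h p q))
    where
    lemma : ∀ h p q → h + p + (h + (p + q + h + (h + p))) ≡ 4 * h + 3 * p + q
    lemma = solve-∀

  -- A common 1-bit `k` opens the route through `w left k` and `w right k`, of length `2ℓ + q`.
  opposite-v-common : ∀ {i j} → ¬ Orthogonal (vec left i) (vec right j) →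
                      W (2 * h + 2 * p + q) (ext (v left i)) (ext (v right j))
  opposite-v-common {i} {j} ¬orth =
    let k , lk , rk = common-bit {l = vec left i} {vec right j} ¬orth in
    Within-≤ G
      (within-length S (vw left i k lk) ► within-length S (ww k) ► Within-sym G (within-length S (vw right j k rk)))
      (≤-reflexive (≡.trans (cong (λ m → m + (q + m)) ℓ≡) (lemma h p q)))
    where
    lemma : ∀ h p q → h + p + (q + (h + p)) ≡ 2 * h + 2 * p + q
    lemma = solve-∀

  -- Lower bound: a potential growing from `u left i`.

  module Lower (i : Fin n) where

    choose : ∀ {A : Set} → Dec A → ℕ → ℕ → ℕ
    choose (yes _) a b = a
    choose (no  _) a b = b

    -- For a 1-bit, `w left k` is one path beyond `v left i`, at `h + ℓ`. For a 0-bit the value is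
    -- `ℓ` above the value `3h + p` of `y left`.
    wL : Fin d → ℕ
    wL k = if Vec.lookup (vec left i) k then 2 * h + p else 4 * h + 2 * p

    -- The first value is `ℓ` above that of `x right`; the second is `h + 2ℓ + q`, the length of the
    -- route through a common bit.
    vR : Fin n → ℕ
    vR j = choose (orthogonal? (vec left i) (vec right j)) (5 * h + 3 * p + q) (3 * h + 2 * p + q)

    -- Agrees with the distance from u left i along shortest paths to each u right j;
    -- the other values only have to be compatible with the path lengths.
    F : OVExterior I ℓ p q → ℕ
    F (u left m)  = choose (m Fin.≟ i) 0 (3 * h + 2 * p)
    F (v left m)  = choose (m Fin.≟ i) h (3 * h + 2 * p)
    F (w left k)  = wL k
    F (x left)    = 2 * h + p
    F (y left)    = 3 * h + p
    F (u right j) = vR j + h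
    F (v right j) = vR j
    F (w right k) = wL k + q
    F (x right)   = 4 * h + 2 * p + q
    F (y right)   = 3 * h + 2 * p + q

    -- Each case passes the smaller of the two values first, with `swap` where that one belongs to
    -- the target.
    F-lipschitz : ∀ π → F (OVSource I ℓ p q π) ≤ F (OVTarget I ℓ p q π) + OVLength I ℓ p q π
                      × F (OVTarget I ℓ p q π) ≤ F (OVSource I ℓ p q π) + OVLength I ℓ p q π
    F-lipschitz (uv left m) with m Fin.≟ i
    ... | yes _ = exact-gap h≡ 0 h refl
    ... | no  _ = by-gap h≡ (3 * h + 2 * p) (3 * h + 2 * p) 0 h (+-identityʳ _) refl
    F-lipschitz (uv right j) = swap (exact-gap h≡ (vR j) (vR j + h) refl)
    F-lipschitz (vx left m) with m Fin.≟ i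
    ... | yes _ = exact-gap ℓ≡ h (2 * h + p) (solve (h ∷ p ∷ []))
    ... | no  _ = swap (exact-gap ℓ≡ (2 * h + p) (3 * h + 2 * p) (solve (h ∷ p ∷ [])))
    F-lipschitz (vx right j) with orthogonal? (vec left i) (vec right j)
    ... | yes _ = swap (exact-gap ℓ≡ (4 * h + 2 * p + q) (5 * h + 3 * p + q) (solve (h ∷ p ∷ q ∷ [])))
    ... | no  _ = by-gap ℓ≡ (3 * h + 2 * p + q) (4 * h + 2 * p + q) h p (solve (h ∷ p ∷ q ∷ [])) refl
    F-lipschitz (vw left m k e) with m Fin.≟ i
    ... | yes refl rewrite e = exact-gap ℓ≡ h (2 * h + p) (solve (h ∷ p ∷ []))
    ... | no  _ with Vec.lookup (vec left i) k
    ...   | true  = swap (exact-gap ℓ≡ (2 * h + p) (3 * h + 2 * p) (solve (h ∷ p ∷ [])))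
    ...   | false = by-gap ℓ≡ (3 * h + 2 * p) (4 * h + 2 * p) h p (solve (h ∷ p ∷ [])) refl
    F-lipschitz (vw right j k e) with orthogonal? (vec left i) (vec right j)
    -- This is where orthogonality enters: bit `k` of the right vector is 1, so bit `k` of the left
    -- vector is 0, and `w right k` has the value `4h + 2p + q`, exactly `ℓ` below `vR j`.
    ... | yes orth with orth k
    ...   | inj₁ lk rewrite lk = swap (exact-gap ℓ≡ (4 * h + 2 * p + q) (5 * h + 3 * p + q) (solve (h ∷ p ∷ q ∷ [])))
    ...   | inj₂ rk = contradiction (≡.trans (≡.sym e) rk) λ ()
    F-lipschitz (vw right j k e) | no _ with Vec.lookup (vec left i) k
    ...   | true  = swap (exact-gap ℓ≡ (2 * h + p + q) (3 * h + 2 * p + q) (solve (h ∷ p ∷ q ∷ [])))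
    ...   | false = by-gap ℓ≡ (3 * h + 2 * p + q) (4 * h + 2 * p + q) h p (solve (h ∷ p ∷ q ∷ [])) refl
    F-lipschitz (yw left k) with Vec.lookup (vec left i) k
    ... | true  = swap (by-gap ℓ≡ (2 * h + p) (3 * h + p) h p (solve (h ∷ p ∷ [])) refl)
    ... | false = exact-gap ℓ≡ (3 * h + p) (4 * h + 2 * p) (solve (h ∷ p ∷ []))
    F-lipschitz (yw right k) with Vec.lookup (vec left i) k
    ... | true  = swap (exact-gap ℓ≡ (2 * h + p + q) (3 * h + 2 * p + q) (solve (h ∷ p ∷ q ∷ [])))
    ... | false = by-gap ℓ≡ (3 * h + 2 * p + q) (4 * h + 2 * p + q) h p (solve (h ∷ p ∷ q ∷ [])) refl
    F-lipschitz (ww k)     = exact-gap refl (wL k) (wL k + q) refl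
    F-lipschitz (xy left)  = exact-gap h≡ (2 * h + p) (3 * h + p) (solve (h ∷ p ∷ []))
    F-lipschitz (xy right) = swap (exact-gap h≡ (3 * h + 2 * p + q) (4 * h + 2 * p + q) (solve (h ∷ p ∷ q ∷ [])))
    F-lipschitz yy         = exact-gap refl (3 * h + p) (3 * h + 2 * p + q) (lemma h p q)
      where
      lemma : ∀ h p q → 3 * h + p + (p + q) ≡ 3 * h + 2 * p + q
      lemma = solve-∀

    vR-orthogonal : ∀ {j} → Orthogonal (vec left i) (vec right j) → vR j ≡ 5 * h + 3 * p + q
    vR-orthogonal {j} orth with orthogonal? (vec left i) (vec right j)
    ... | yes _    = refl
    ... | no ¬orth = contradiction orth ¬orth

    vR-common : ∀ {j} → ¬ Orthogonal (vec left i) (vec right j) → vR j ≡ 3 * h + 2 * p + q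
    vR-common {j} ¬orth with orthogonal? (vec left i) (vec right j)
    ... | yes orth = contradiction orth ¬orth
    ... | no _     = refl

    F-u-left : F (u left i) ≡ 0
    F-u-left with i Fin.≟ i
    ... | yes _ = refl
    ... | no i≢i = contradiction refl i≢i

    walk-≥ : ∀ {j k} → Walk G (ext (u left i)) (ext (u right j)) k → vR j + h ≤ k
    walk-≥ {j} {k} walk =
      subst (λ m → vR j + h ≤ m + k) F-u-left (potential-walk S F F-lipschitz walk)

-- Size bounds.

module _ {n d ℓ p q : ℕ} .{{_ : NonZero n}} .{{_ : NonZero d}} .{{_ : NonZero ℓ}} where

  private
    A B : ℕ
    A = n * d * ℓ
    B = d * q

    n≤n*d : n ≤ n * d
    n≤n*d = m≤m*n n d

    d≤n*d : d ≤ n * d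
    d≤n*d = m≤n*m d n

    ≤A : ∀ {m} → m ≤ n * d → m ≤ A
    ≤A m≤ = ≤-trans m≤ (m≤m*n (n * d) ℓ)

    ℓ≤A : ℓ ≤ A
    ℓ≤A = m≤n*m ℓ (n * d) {{m*n≢0 n d}}

    2*≤ : ∀ a b → a ≤ n * d → b ≤ ℓ → 2 * a * b ≤ 2 * A
    2*≤ a b a≤ b≤ = ≤-trans (≤-reflexive (*-assoc 2 a b)) (*-monoʳ-≤ 2 (*-mono-≤ a≤ b≤))

  -- Each of `n`, `d` and 1 is at most `A`, so the coefficients 2, 2, 2 and 4 add up to 10.
  exterior-bound : 2 * n + (2 * n + (2 * d + (2 + 2))) ≤ 10 * A
  exterior-bound = ≤-trans
    (+-mono-≤ (*-monoʳ-≤ 2 (≤A n≤n*d)) (+-mono-≤ (*-monoʳ-≤ 2 (≤A n≤n*d))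
      (+-mono-≤ (*-monoʳ-≤ 2 (≤A d≤n*d)) (*-monoʳ-≤ 4 (≤-trans (>-nonZero⁻¹ ℓ) ℓ≤A)))))
    (≤-reflexive (lemma A))
    where
    lemma : ∀ a → 2 * a + (2 * a + (2 * a + 4 * a)) ≡ 10 * a
    lemma = solve-∀

  -- The kinds `uv`, `vx`, `vw`, `yw` and `xy` contribute at most `2A` each, `ww` contributes `B`,
  -- and `yy` at most `A + B`, giving `11A + 2B`.
  slot-bound : (I : OVInstance n d) → p ≤ 1 → slot-count I ℓ p q ≤ 11 * (A + B)
  slot-bound I p≤1 = ≤-trans
    (+-mono-≤ (2*≤ n _ n≤n*d (m∸n≤m ℓ p))
    (+-mono-≤ (2*≤ n ℓ n≤n*d ≤-refl)
    (+-mono-≤ (≤-trans (≤-reflexive (cong (_* ℓ) (*-identityʳ (2 * (n * d))))) (2*≤ (n * d) ℓ ≤-refl ≤-refl))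
    (+-mono-≤ (2*≤ d ℓ d≤n*d ≤-refl)
    (+-mono-≤ (≤-refl {B})
    (+-mono-≤ (*-monoʳ-≤ 2 (≤-trans (m∸n≤m ℓ p) ℓ≤A))
    (+-mono-≤ (≤-trans p≤1 (≤-trans (>-nonZero⁻¹ ℓ) ℓ≤A)) (m≤n*m q d))))))))
    (by-slack (9 * B) (lemma A B))
    where
    lemma : ∀ a b → 2 * a + (2 * a + (2 * a + (2 * a + (b + (2 * a + (a + b)))))) + 9 * b ≡ 11 * (a + b)
    lemma = solve-∀

  vertex-bound : (I : OVInstance n d) → p ≤ 1 →
                 2 * n + (2 * n + (2 * d + (2 + 2))) + slot-count I ℓ p q ≤ 21 * (A + B)
  vertex-bound I p≤1 = ≤-trans (+-mono-≤ exterior-bound (slot-bound I p≤1))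
    (by-slack (10 * B) (lemma A B))
    where
    lemma : ∀ a b → 10 * a + 11 * (a + b) + 10 * b ≡ 21 * (a + b)
    lemma = solve-∀

-- The diameter in both cases, and the theorem.

module Diameter {n d : ℕ} (I : OVInstance n d) (ℓ p q : ℕ) (1≤ℓ : 1 ≤ ℓ) (p≤1 : p ≤ 1) where
  open OVInstance I

  private
    G : Graph
    G = OVGraph I ℓ p q

    h : ℕ
    h = ℓ ∸ p

    ℓ≡h+p : ℓ ≡ h + p
    ℓ≡h+p = ≡.sym (m∸n+n≡m (≤-trans p≤1 1≤ℓ))

  open Distances I ℓ p q h p≤1 refl ℓ≡h+p

  distance-exists : ∀ {a b D} → Within G D a b → ∃[ k ] (IsDistance G a b k × k ≤ D)
  distance-exists {a} {b} (m , r , m≤D) =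
    let k , dist , k≤m = least (Walk-decidable G (OV-≈-decidable I ℓ p q 1≤ℓ)
                                  (edges-covered (OVSystem I ℓ p q) (finite-slots I ℓ p q)) a b) m r
    in k , dist , ≤-trans k≤m m≤D

  -- When `vR j` reaches `h + E`, the potential of `u right j` equals the upper bound `h + E + h`,
  -- so `u left i` and `u right j` realise the diameter.
  diameter : ∀ E → 2 * h + 2 * p + q ≤ E →
             (∀ i j → Within G E (ext (v left i)) (ext (v right j))) →
             ∀ i j → Lower.vR i j ≡ h + E → IsDiameter G (h + E + h)
  diameter E E≥ opposite-v i j vR≡ =
    (λ a b → distance-exists (within-D E E≥ opposite-v a b)) ,
    ext (u left i) , ext (u right j) ,
    within-bound⇒distance G (within-D E E≥ opposite-v _ _)
      (λ k r → subst (λ m → m + h ≤ k) vR≡ (Lower.walk-≥ i r))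

  -- The route through the `x` and `y` vertices gives `E = 4h + 3p + q`, and the potential from the
  -- orthogonal pair matches it. The total `6h + 3p + q` is the claim, since `ℓ = h + p`.
  pair-diameter : ContainsOrthogonalPair I → IsDiameter G ((6 * ℓ ∸ 3 * p) + q)
  pair-diameter (i , j , orth) = subst (IsDiameter G) D≡
    (diameter (4 * h + 3 * p + q) (by-slack (2 * h + p) (slack h p q)) opposite-v-orthogonal i j
      (≡.trans (Lower.vR-orthogonal i orth) (vR≡ h p q)))
    where
    slack : ∀ h p q → 2 * h + 2 * p + q + (2 * h + p) ≡ 4 * h + 3 * p + q
    slack = solve-∀
    vR≡ : ∀ h p q → 5 * h + 3 * p + q ≡ h + (4 * h + 3 * p + q)
    vR≡ = solve-∀
    regroup : ∀ h p q → h + (4 * h + 3 * p + q) + h ≡ 6 * h + 3 * p + q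
    regroup = solve-∀
    expand : ∀ h p → 6 * (h + p) ≡ 6 * h + 3 * p + 3 * p
    expand = solve-∀
    D≡ : h + (4 * h + 3 * p + q) + h ≡ (6 * ℓ ∸ 3 * p) + q
    D≡ = ≡.trans (regroup h p q) (cong (_+ q)
      (∸-from-+ (≡.trans (cong (6 *_) ℓ≡h+p) (expand h p))))

  -- Every left vector shares a 1-bit with every right one, so `E = 2h + 2p + q` holds throughout;
  -- the given index, used on both sides, supplies a pair at this distance.
  no-pair-diameter : Fin n → ¬ ContainsOrthogonalPair I → IsDiameter G ((4 * ℓ ∸ 2 * p) + q)
  no-pair-diameter i none = subst (IsDiameter G) D≡
    (diameter (2 * h + 2 * p + q) ≤-refl (λ i j → opposite-v-common (¬orth i j)) i i
      (≡.trans (Lower.vR-common i (¬orth i i)) (vR≡ h p q)))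
    where
    ¬orth : ∀ i j → ¬ Orthogonal (vec left i) (vec right j)
    ¬orth i j orth = none (i , j , orth)
    vR≡ : ∀ h p q → 3 * h + 2 * p + q ≡ h + (2 * h + 2 * p + q)
    vR≡ = solve-∀
    regroup : ∀ h p q → h + (2 * h + 2 * p + q) + h ≡ 4 * h + 2 * p + q
    regroup = solve-∀
    expand : ∀ h p → 4 * (h + p) ≡ 4 * h + 2 * p + 2 * p
    expand = solve-∀
    D≡ : h + (2 * h + 2 * p + q) + h ≡ (4 * ℓ ∸ 2 * p) + q
    D≡ = ≡.trans (regroup h p q) (cong (_+ q)
      (∸-from-+ (≡.trans (cong (4 *_) ℓ≡h+p) (expand h p))))

theorem3p1 : ∃[ c ] ((n d : ℕ) → 1 ≤ n → 1 ≤ d → (I : OVInstance n d) →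
    (ℓ p q : ℕ) → 1 ≤ ℓ → p ≡ 0 ⊎ p ≡ 1 →
    let G = OVGraph I ℓ p q in
    (∃[ N ] (HasCardinality (Graph.vertices G) N × N ≤ c * (n * d * ℓ + d * q)))
    × (∃[ M ] (HasCardinality (edges G) M × M ≤ c * (n * d * ℓ + d * q)))
    × (∃[ D ] (IsDiameter G D
    × (ContainsOrthogonalPair I → D ≡ (6 * ℓ ∸ 3 * p) + q)
    × (¬ ContainsOrthogonalPair I → D ≡ (4 * ℓ ∸ 2 * p) + q))))
-- The constant is 10 for exterior vertices plus 11 for slots; the edge bound 11 is relaxed to it.
-- Matching on successors yields the `NonZero` instances and the index `zero`.
theorem3p1 = 21 , λ { n@(suc _) d@(suc _) _ _ I ℓ@(suc _) p q 1≤ℓ p≡0⊎1 →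
  let p≤1  = [ (λ { refl → z≤n }) , ≤-reflexive ] p≡0⊎1
      S    = OVSystem I ℓ p q
      G    = OVGraph I ℓ p q
      _≟_  = OV-≈-decidable I ℓ p q 1≤ℓ
      N , N-vertices , N≤ = covered⇒cardinality _ _≟_
        (vertices-covered S (finite-exterior I ℓ p q) (finite-slots I ℓ p q))
      M , M-edges , M≤ = covered⇒cardinality _ (edges-decidable G _≟_)
        (edges-covered S (finite-slots I ℓ p q))
  in (N , N-vertices , ≤-trans N≤ (vertex-bound {n} {d} {ℓ} {p} {q} I p≤1))
   , (M , M-edges , ≤-trans M≤ (≤-trans (slot-bound {n} {d} {ℓ} {p} {q} I p≤1)
                     (*-monoˡ-≤ (n * d * ℓ + d * q) (m≤m+n 11 10))))
   , diameter-by-cases I ℓ p q 1≤ℓ p≤1 zero (contains? I) }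
  where
  -- Existence of an orthogonal pair is decidable, so the diameter is chosen by cases; the
  -- implication for the other case then has a contradictory premise.
  diameter-by-cases : ∀ {n d} (I : OVInstance n d) ℓ p q → 1 ≤ ℓ → p ≤ 1 → Fin n →
    Dec (ContainsOrthogonalPair I) →
    ∃[ D ] (IsDiameter (OVGraph I ℓ p q) D
    × (ContainsOrthogonalPair I → D ≡ (6 * ℓ ∸ 3 * p) + q)
    × (¬ ContainsOrthogonalPair I → D ≡ (4 * ℓ ∸ 2 * p) + q))
  diameter-by-cases I ℓ p q 1≤ℓ p≤1 i (yes pair) =
    _ , Diameter.pair-diameter I ℓ p q 1≤ℓ p≤1 pair , (λ _ → refl) , contradiction pair
  diameter-by-cases I ℓ p q 1≤ℓ p≤1 i (no none) =
    _ , Diameter.no-pair-diameter I ℓ p q 1≤ℓ p≤1 i none , (λ pair → contradiction pair none) , λ _ → refl
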